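{- Let $G$ be a connected block graph that is not a complete graph, let $T_G$ be its block-cutpoint graph, and let $g:V(T_G)\to\{0,1,2\}$. Then the following are equivalent. (a) There is an R2DF $f$ of $G$ of weight $\gamma_{\{R2\}}(G)$ such that (L1) for every block $H$ of type 1 and every vertex $v\in V(H)$ that is not a cut-vertex, $f(v)\in\{0,1\}$; (L2) for every block $H$ of type 2 and every vertex $v\in V(H)$ that is not a cut-vertex, $f(v)=0$; and $g$ is the function induced by $f$, i.e. $g(v)=f(v)$ for every cut-vertex $v$ of $G$ and $g(h_H)=\sum_{v\in V(H)} f(v)-\sum_{v\in I_H} f(v)$ for every block $H$, where $I_H$ is the set of cut-vertices of $G$ lying in $H$. (b) $g$ satisfies all of the following: 1. if $H$ is a block of type 1, then $g(h_H)\in\{0,1\}$; 2. if $H$ is a block of type 0 or type 2, then $g(h_H)=0$; 3. if $v$ is a cut-vertex with $g(v)=0$, then either there is a vertex $u\ne v$ of $T_G$ at distance at most $2$ from $v$ in $T_G$ with $g(u)=2$, or there are two distinct vertices $u_1,u_2\ne v$ of $T_G$ at distance at most $2$ from $v$ in $T_G$ with $g(u_1)=g(u_2)=1$; 4. if $H$ is a block of type 1 or type 2 with $g(h_H)=0$, then either there is $u\in N_{T_G}(h_H)$ with $g(u)=2$, or there are distinct $u_1,u_2\in N_{T_G}(h_H)$ with $g(u_1)=g(u_2)=1$; 5. $\sum_{x\in V(T_G)} g(x)=\gamma_{\{R2\}}(G)$.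
   Context: For a graph $G=(V,E)$, a Roman $\{2\}$-dominating function (R2DF) is a function $f:V\to\{0,1,2\}$ such that every vertex $v$ with $f(v)=0$ satisfies $\sum_{u\in N(v)} f(u)\ge 2$; its weight is $\sum_{v\in V} f(v)$, and $\gamma_{\{R2\}}(G)$ is the minimum weight of an R2DF. A cut-vertex is a vertex whose removal increases the number of connected components. A block is a maximal connected induced subgraph without a cut-vertex; $G$ is a block graph if every block is complete. The block-cutpoint graph $T_G$ of a connected graph $G$ is the bipartite tree whose vertices are the cut-vertices of $G$ and one vertex $h_H$ per block $H$, with $v h_H$ an edge iff the cut-vertex $v$ lies in $H$. For a block $H$ with $I_H$ the set of cut-vertices of $G$ in $H$: $H$ is of type 0 if $|V(H)|=|I_H|$, of type 1 if $|V(H)|=|I_H|+1$, and of type 2 if $|V(H)|\ge |I_H|+2$. -}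

module Defs where

open import Data.Nat using (ℕ; zero; suc; _+_; _≤_)
open import Data.Fin using (Fin)
open import Data.Fin.Subset using (Subset; _∈_; _∉_; _⊆_; ⊤; _-_; ∣_∣; inside; outside)
open import Data.List using (List; []; _∷_; map; _++_; allFin)
open import Data.Nat.ListAction using (sum)
open import Data.Vec using (Vec; []; _∷_)
open import Data.Bool using (if_then_else_)
open import Data.Product using (Σ; ∃; ∃₂; _×_; _,_)
open import Data.Sum using (_⊎_)
open import Relation.Nullary using (¬_; Dec; does)
open import Relation.Binary.PropositionalEquality using (_≡_; _≢_)

record Graph (n : ℕ) : Set₁ where
  field
    E      : Fin n → Fin n → Set
    adj?   : ∀ u v → Dec (E u v)
    sym    : ∀ {u v} → E u v → E v u
    irrefl : ∀ {u} → ¬ E u u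
open Graph public

-- Relational "sum of f over the elements of xs satisfying P"
-- (P need not be decidable; the value is determined since P x / ¬ P x
-- are exclusive).

data SumP {A : Set} (P : A → Set) (f : A → ℕ) : List A → ℕ → Set where
  nil  : SumP P f [] 0
  yes  : ∀ {x xs s} → P x → SumP P f xs s → SumP P f (x ∷ xs) (f x + s)
  no   : ∀ {x xs s} → ¬ P x → SumP P f xs s → SumP P f (x ∷ xs) s

allSubsets : ∀ n → List (Subset n)
allSubsets zero    = [] ∷ []
allSubsets (suc n) = map (inside ∷_) (allSubsets n) ++ map (outside ∷_) (allSubsets n)

module _ {n : ℕ} (G : Graph n) where

  data Reach (S : Subset n) (u : Fin n) : Fin n → Set where
    here : u ∈ S → Reach S u u
    step : ∀ {w v} → Reach S u w → E G w v → v ∈ S → Reach S u v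

  Connected : Subset n → Set
  Connected S = ∀ u v → u ∈ S → v ∈ S → Reach S u v

  -- v is a cut-vertex of G[S]: removing v increases the number of
  -- connected components, i.e. two vertices u, w ≠ v of the component of
  -- v become disconnected.
  IsCutIn : Subset n → Fin n → Set
  IsCutIn S v = v ∈ S × ∃₂ λ u w → u ∈ S × w ∈ S × u ≢ v × w ≢ v ×
                 Reach S u w × ¬ Reach (S - v) u w

  NoCutVertex : Subset n → Set
  NoCutVertex S = ∀ v → ¬ IsCutIn S v

  IsBlock : Subset n → Set
  IsBlock S = Connected S × NoCutVertex S ×
              (∀ T → S ⊆ T → Connected T → NoCutVertex T → T ⊆ S)

  IsCut : Fin n → Set
  IsCut v = IsCutIn ⊤ v

  IsComplete : Set
  IsComplete = ∀ u v → u ≢ v → E G u v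

  IsBlockGraph : Set
  IsBlockGraph = ∀ H → IsBlock H → ∀ u v → u ∈ H → v ∈ H → u ≢ v → E G u v

  NumCutIn : Subset n → ℕ → Set
  NumCutIn H c = SumP (λ v → v ∈ H × IsCut v) (λ _ → 1) (allFin n) c

  Type0 Type1 Type2 : Subset n → Set
  Type0 H = ∃ λ c → NumCutIn H c × ∣ H ∣ ≡ c
  Type1 H = ∃ λ c → NumCutIn H c × ∣ H ∣ ≡ suc c
  Type2 H = ∃ λ c → NumCutIn H c × suc (suc c) ≤ ∣ H ∣

  weight : (Fin n → ℕ) → ℕ
  weight f = sum (map f (allFin n))

  nbrSum : (Fin n → ℕ) → Fin n → ℕ
  nbrSum f v = sum (map (λ u → if does (adj? G v u) then f u else 0) (allFin n))

  IsR2DF : (Fin n → ℕ) → Set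
  IsR2DF f = (∀ v → f v ≤ 2) × (∀ v → f v ≡ 0 → 2 ≤ nbrSum f v)

  IsGammaR2 : ℕ → Set
  IsGammaR2 γ = (∃ λ f → IsR2DF f × weight f ≡ γ) ×
                (∀ f → IsR2DF f → γ ≤ weight f)

  -- Block-cutpoint graph T_G.  Carrier: inj₁ v for vertices, inj₂ H for
  -- vertex subsets; the vertices of T_G are the inj₁ v with v a cut-vertex
  -- and the inj₂ H (= h_H) with H a block.
  TV : Set
  TV = Fin n ⊎ Subset n

  IsTV : TV → Set
  IsTV (_⊎_.inj₁ v) = IsCut v
  IsTV (_⊎_.inj₂ H) = IsBlock H

  TAdj : TV → TV → Set
  TAdj (_⊎_.inj₁ v) (_⊎_.inj₂ H) = IsCut v × IsBlock H × v ∈ H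
  TAdj (_⊎_.inj₂ H) (_⊎_.inj₁ v) = IsCut v × IsBlock H × v ∈ H
  TAdj _ _ = Data.Empty.⊥
    where import Data.Empty

  Dist≤2 : TV → TV → Set
  Dist≤2 x y = x ≡ y ⊎ TAdj x y ⊎ (∃ λ z → TAdj x z × TAdj z y)

  allTV : List TV
  allTV = map _⊎_.inj₁ (allFin n) ++ map _⊎_.inj₂ (allSubsets n)

  Induced : (Fin n → ℕ) → (TV → ℕ) → Set
  Induced f g =
    (∀ v → IsCut v → g (_⊎_.inj₁ v) ≡ f v) ×
    (∀ H → IsBlock H → ∃₂ λ a b →
        SumP (_∈ H) f (allFin n) a ×
        SumP (λ v → v ∈ H × IsCut v) f (allFin n) b ×
        g (_⊎_.inj₂ H) + b ≡ a)

  CondA : ℕ → (TV → ℕ) → Set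
  CondA γ g = ∃ λ f → IsR2DF f × weight f ≡ γ ×
    (∀ H → IsBlock H → Type1 H → ∀ v → v ∈ H → ¬ IsCut v → f v ≤ 1) ×
    (∀ H → IsBlock H → Type2 H → ∀ v → v ∈ H → ¬ IsCut v → f v ≡ 0) ×
    Induced f g

  CondB : ℕ → (TV → ℕ) → Set
  CondB γ g =
    (∀ H → IsBlock H → Type1 H → g (_⊎_.inj₂ H) ≤ 1) ×
    (∀ H → IsBlock H → Type0 H ⊎ Type2 H → g (_⊎_.inj₂ H) ≡ 0) ×
    (∀ v → IsCut v → g (_⊎_.inj₁ v) ≡ 0 →
       (∃ λ u → IsTV u × u ≢ _⊎_.inj₁ v × Dist≤2 (_⊎_.inj₁ v) u × g u ≡ 2)
       ⊎ (∃₂ λ u₁ u₂ → IsTV u₁ × IsTV u₂ × u₁ ≢ u₂ ×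
            u₁ ≢ _⊎_.inj₁ v × u₂ ≢ _⊎_.inj₁ v ×
            Dist≤2 (_⊎_.inj₁ v) u₁ × Dist≤2 (_⊎_.inj₁ v) u₂ ×
            g u₁ ≡ 1 × g u₂ ≡ 1)) ×
    (∀ H → IsBlock H → Type1 H ⊎ Type2 H → g (_⊎_.inj₂ H) ≡ 0 →
       (∃ λ u → TAdj (_⊎_.inj₂ H) u × g u ≡ 2)
       ⊎ (∃₂ λ u₁ u₂ → u₁ ≢ u₂ × TAdj (_⊎_.inj₂ H) u₁ × TAdj (_⊎_.inj₂ H) u₂ ×
            g u₁ ≡ 1 × g u₂ ≡ 1)) ×
    SumP IsTV g allTV γ

{-# OPTIONS --safe #-}
module Submission where

-- A vertex v that is not a cut-vertex lies in exactly one block: a simple path avoiding v between two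
-- neighbours of v closes up through v to a 2-connected set, which lies in a block and so is a clique;
-- hence the union of two blocks through v is a clique, and maximality makes them equal. Each vertex v of
-- G therefore has a carrier in T_G, namely v itself if it is a cut-vertex and the node of its only block
-- otherwise. In both directions of the equivalence f is g ∘ carrier: L1 and L2 say that a nonzero label
-- in a block is carried by at most one of its non-cut vertices. Labels of neighbours in G thus
-- correspond to labels at distance at most 2 in T_G, and grouping the non-cut vertices by their block
-- identifies the two total weights.

open import Defs renaming (sym to E-sym; yes to take; no to skip)
open import Function.Bundles using (_⇔_; mk⇔)
open import Function using (_∘_; id)
open import Data.Nat using (ℕ; zero; suc; _+_; _*_; _≤_; z≤n; s≤s; s≤s⁻¹)
open import Data.Nat.Properties
open import Data.Nat.ListAction using (sum)
open import Data.Nat.ListAction.Properties using (sum-++)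
open import Data.Bool using (if_then_else_)
open import Data.Fin using (Fin; zero; suc)
import Data.Fin.Properties as Fin
open import Data.Fin.Subset using (Subset; _∈_; _∉_; _⊆_; _⊂_; _⊃_; _-_; _∪_; ⁅_⁆; ∣_∣; ⊤;
  inside; outside)
open import Data.Fin.Subset.Properties
open import Data.Fin.Subset.Induction using (⊂-wellFounded; ⊃-wellFounded)
open import Induction.WellFounded using (Acc; acc)
open import Data.List using (List; []; _∷_; map; _++_; allFin; tabulate)
open import Data.List.Properties using (map-cong; map-∘; map-++; map-tabulate)
import Data.List.Membership.Propositional as List
open import Data.List.Membership.Propositional.Properties
  using (∈-allFin; ∈-map⁺; ∈-map⁻; ∈-++⁺ˡ; ∈-++⁺ʳ)
open import Data.List.Relation.Unary.Any using (here; there)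
open import Data.List.Relation.Unary.All as All using (All; []; _∷_)
open import Data.List.Relation.Unary.AllPairs using ([]; _∷_)
open import Data.List.Relation.Unary.Unique.Propositional using (Unique)
open import Data.List.Relation.Unary.Unique.Propositional.Properties using (map⁺; ++⁺; allFin⁺)
open import Data.Vec using ([]; _∷_; here; there)
open import Data.Vec.Properties using (∷-injectiveʳ)
open import Data.Product using (∃; ∃₂; _×_; _,_; proj₁; proj₂)
import Data.Sum as Sum
open import Data.Sum using (_⊎_; inj₁; inj₂; [_,_]′)
open import Data.Sum.Properties using (inj₁-injective; inj₂-injective)
open import Relation.Nullary using (¬_; Dec; does; yes; no; contradiction; map′; ¬?; _×-dec_; _→-dec_)
open import Relation.Nullary.Decidable using (decidable-stable)
open import Relation.Unary using (Decidable)
open import Relation.Binary.PropositionalEquality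

private variable
  A B : Set
  n : ℕ

-- Sums over lists with decidable guards.

infix 5 _when_
_when_ : ℕ → Dec A → ℕ
m when d = if does d then m else 0

when-yes : ∀ {m} (d : Dec A) → A → m when d ≡ m
when-yes (yes _) _ = refl
when-yes (no ¬a) a = contradiction a ¬a

when-no : ∀ {m} (d : Dec A) → ¬ A → m when d ≡ 0
when-no (yes a) ¬a = contradiction a ¬a
when-no (no _)  _  = refl

when-positive : ∀ {m} k (d : Dec A) → suc k ≤ m when d → A × suc k ≤ m
when-positive k (yes a) le = a , le

when-cong : ∀ {x y} (d : Dec A) → (A → x ≡ y) → x when d ≡ y when d
when-cong (yes a) eq = eq a
when-cong (no _)  _  = refl

when-zero : (d : Dec A) → 0 when d ≡ 0
when-zero (yes _) = refl
when-zero (no _)  = refl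

when-complement : ∀ m (d : Dec A) → (m when d) + (m when ¬? d) ≡ m
when-complement m (yes _) = +-identityʳ m
when-complement m (no _)  = refl

when-split : ∀ m (d : Dec A) (e : Dec B) →
  m when d ≡ (m when (d ×-dec e)) + (m when (d ×-dec ¬? e))
when-split m (yes _) e = sym (when-complement m e)
when-split m (no _)  _ = refl

when-scale : ∀ {m} c (d : Dec A) → (A → m ≡ c) → m when d ≡ (1 when d) * c
when-scale c (yes a) eq = trans (eq a) (sym (*-identityˡ c))
when-scale c (no _)  _  = refl

sumOver : List A → (A → ℕ) → ℕ
sumOver xs f = sum (map f xs)

sumOver-cong : ∀ {f h : A → ℕ} → (∀ x → f x ≡ h x) → ∀ xs → sumOver xs f ≡ sumOver xs h
sumOver-cong eq xs = cong sum (map-cong eq xs)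

sumOver-zero : ∀ {f : A → ℕ} {xs} → All (λ x → f x ≡ 0) xs → sumOver xs f ≡ 0
sumOver-zero []         = refl
sumOver-zero (eq ∷ eqs) = cong₂ _+_ eq (sumOver-zero eqs)

sumOver-+ : ∀ (f h : A → ℕ) xs →
  sumOver xs (λ x → f x + h x) ≡ sumOver xs f + sumOver xs h
sumOver-+ f h []       = refl
sumOver-+ f h (x ∷ xs) = begin
  f x + h x + sumOver xs (λ y → f y + h y)     ≡⟨ cong (f x + h x +_) (sumOver-+ f h xs) ⟩
  f x + h x + (sumOver xs f + sumOver xs h)    ≡⟨ +-assoc (f x) (h x) _ ⟩
  f x + (h x + (sumOver xs f + sumOver xs h))  ≡⟨ cong (f x +_) (x∙yz≈y∙xz (h x) (sumOver xs f) _) ⟩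
  f x + (sumOver xs f + (h x + sumOver xs h))  ≡⟨ +-assoc (f x) _ _ ⟨
  f x + sumOver xs f + (h x + sumOver xs h)    ∎
  where
  open ≡-Reasoning
  open import Algebra.Properties.CommutativeSemigroup +-commutativeSemigroup using (x∙yz≈y∙xz)

sumOver-* : ∀ (f : A → ℕ) c xs → sumOver xs (λ x → f x * c) ≡ sumOver xs f * c
sumOver-* f c []       = refl
sumOver-* f c (x ∷ xs) =
  trans (cong (f x * c +_) (sumOver-* f c xs)) (sym (*-distribʳ-+ c (f x) _))

sumOver-swap : ∀ (h : A → B → ℕ) xs ys →
  sumOver xs (λ x → sumOver ys (h x)) ≡ sumOver ys (λ y → sumOver xs (λ x → h x y))
sumOver-swap h []       ys = sym (sumOver-zero (All.universal (λ _ → refl) ys))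
sumOver-swap h (x ∷ xs) ys =
  trans (cong (sumOver ys (h x) +_) (sumOver-swap h xs ys)) (sym (sumOver-+ (h x) _ ys))

sumOver-when : ∀ (f : B → ℕ) xs (d : Dec A) →
  sumOver xs f when d ≡ sumOver xs (λ x → f x when d)
sumOver-when f xs (yes _) = refl
sumOver-when f xs (no _)  = sym (sumOver-zero (All.universal (λ _ → refl) xs))

sumOver-map : ∀ (f : B → ℕ) (h : A → B) xs → sumOver (map h xs) f ≡ sumOver xs (f ∘ h)
sumOver-map f h xs = cong sum (sym (map-∘ xs))

sumOver-++ : ∀ (f : A → ℕ) xs ys → sumOver (xs ++ ys) f ≡ sumOver xs f + sumOver ys f
sumOver-++ f xs ys = trans (cong sum (map-++ f xs ys)) (sum-++ (map f xs) _)

sumOver-single : ∀ {f : A → ℕ} {x xs} → Unique xs → x List.∈ xs →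
  (∀ y → y ≢ x → f y ≡ 0) → sumOver xs f ≡ f x
sumOver-single {f = f} {x} (x∉ ∷ _) (here refl) vanish =
  trans (cong (f x +_) (sumOver-zero (All.map (λ x≢y → vanish _ (x≢y ∘ sym)) x∉))) (+-identityʳ _)
sumOver-single {f = f} (y∉ ∷ uniq) (there x∈) vanish =
  cong₂ _+_ (vanish _ (All.lookup y∉ x∈)) (sumOver-single uniq x∈ vanish)

term≤sumOver : ∀ (f : A → ℕ) {x xs} → x List.∈ xs → f x ≤ sumOver xs f
term≤sumOver f (here refl) = m≤m+n _ _
term≤sumOver f (there x∈)  = ≤-trans (term≤sumOver f x∈) (m≤n+m _ _)

terms≤sumOver : ∀ (f : A → ℕ) {x y xs} → x ≢ y → x List.∈ xs → y List.∈ xs →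
  f x + f y ≤ sumOver xs f
terms≤sumOver f x≢y (here refl) (here refl) = contradiction refl x≢y
terms≤sumOver f x≢y (here refl) (there y∈)  = +-monoʳ-≤ _ (term≤sumOver f y∈)
terms≤sumOver f {x} {y} x≢y (there x∈) (here refl) =
  ≤-trans (≤-reflexive (+-comm (f x) (f y))) (+-monoʳ-≤ (f y) (term≤sumOver f x∈))
terms≤sumOver f x≢y (there x∈) (there y∈) = ≤-trans (terms≤sumOver f x≢y x∈ y∈) (m≤n+m _ _)

sumOver≥1 : ∀ (f : A → ℕ) xs → 1 ≤ sumOver xs f → ∃ λ x → x List.∈ xs × 1 ≤ f x
sumOver≥1 f (x ∷ xs) le with f x in eq
... | suc _ = x , here refl , subst (1 ≤_) (sym eq) (s≤s z≤n)
... | zero  = let y , y∈ , pos = sumOver≥1 f xs le in y , there y∈ , pos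

-- If the first nonzero term is 1, the rest of the list still sums to at least 1 and yields `y`;
-- uniqueness of the list keeps `y` apart from `x`.
sumOver≥2 : ∀ (f : A → ℕ) {xs} → Unique xs → 2 ≤ sumOver xs f →
  (∃ λ x → 2 ≤ f x) ⊎ (∃₂ λ x y → x ≢ y × 1 ≤ f x × 1 ≤ f y)
sumOver≥2 f {x ∷ xs} (x∉ ∷ uniq) le with f x in eq
... | zero        = sumOver≥2 f uniq le
... | suc (suc _) = inj₁ (x , subst (2 ≤_) (sym eq) (s≤s (s≤s z≤n)))
... | suc zero    =
  let y , y∈ , pos = sumOver≥1 f xs (s≤s⁻¹ le)
  in inj₂ (x , y , All.lookup x∉ y∈ , subst (1 ≤_) (sym eq) ≤-refl , pos)

-- The way in which vertices satisfying P protect a vertex of label 0.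
Two : (A → Set) → (A → ℕ) → Set
Two P f = (∃ λ x → P x × f x ≡ 2) ⊎
          (∃₂ λ x y → x ≢ y × P x × P y × f x ≡ 1 × f y ≡ 1)

-- Serves both directions of the theorem, where `_~_` matches vertices of `G` with nodes of T_G.
-- Only elements of positive label need a partner, and injectivity of `_~_` keeps the two elements
-- of label 1 distinct.
Two-map : ∀ {P : A → Set} {f : A → ℕ} {Q : B → Set} {h : B → ℕ} (_~_ : A → B → Set) →
  (∀ x → P x → 1 ≤ f x → ∃ λ y → Q y × h y ≡ f x × x ~ y) →
  (∀ {x x' y} → x ~ y → x' ~ y → x ≡ x') →
  Two P f → Two Q h
Two-map _ send inj (inj₁ (x , px , fx)) =
  let y , qy , eq , _ = send x px (subst (1 ≤_) (sym fx) (s≤s z≤n))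
  in inj₁ (y , qy , trans eq fx)
Two-map _~_ send inj (inj₂ (x , x' , x≢x' , px , px' , fx , fx')) =
  let y  , qy  , eq  , r  = send x  px  (≤-reflexive (sym fx))
      y' , qy' , eq' , r' = send x' px' (≤-reflexive (sym fx'))
  in inj₂ (y , y' , (λ y≡y' → x≢x' (inj r (subst (x' ~_) (sym y≡y') r'))) , qy , qy' ,
           trans eq fx , trans eq' fx')

≥1∧≤2 : ∀ {m} → 1 ≤ m → m ≤ 2 → m ≡ 1 ⊎ m ≡ 2
≥1∧≤2 {1} _ _ = inj₁ refl
≥1∧≤2 {2} _ _ = inj₂ refl
≥1∧≤2 {suc (suc (suc _))} _ (s≤s (s≤s ()))

module _ {P : A → Set} (P? : Decidable P) {f : A → ℕ} {xs : List A} where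

  -- `nbrSum` is by definition a guarded sum of this form, so this lemma and its converse translate
  -- the R2DF inequality into the alternatives of conditions 3 and 4. The bound on `f` turns a term
  -- of at least 2 into one that equals 2.
  sumOver≥2⇒Two : Unique xs → (∀ x → f x ≤ 2) → 2 ≤ sumOver xs (λ x → f x when P? x) → Two P f
  sumOver≥2⇒Two uniq f≤2 le with sumOver≥2 (λ x → f x when P? x) uniq le
  ... | inj₁ (x , fx≥2) =
    let px , 2≤ = when-positive 1 (P? x) fx≥2 in inj₁ (x , px , ≤-antisym (f≤2 x) 2≤)
  ... | inj₂ (x , y , x≢y , fx , fy)
    with when-positive 0 (P? x) fx | when-positive 0 (P? y) fy
  ... | px , 1≤fx | py , 1≤fy with ≥1∧≤2 1≤fx (f≤2 x) | ≥1∧≤2 1≤fy (f≤2 y)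
  ... | inj₂ fx≡2 | _         = inj₁ (x , px , fx≡2)
  ... | inj₁ _    | inj₂ fy≡2 = inj₁ (y , py , fy≡2)
  ... | inj₁ fx≡1 | inj₁ fy≡1 = inj₂ (x , y , x≢y , px , py , fx≡1 , fy≡1)

  Two⇒sumOver≥2 : (∀ x → x List.∈ xs) → Two P f → 2 ≤ sumOver xs (λ x → f x when P? x)
  Two⇒sumOver≥2 all∈ (inj₁ (x , px , fx)) =
    ≤-trans (≤-reflexive (sym (trans (when-yes (P? x) px) fx))) (term≤sumOver _ (all∈ x))
  Two⇒sumOver≥2 all∈ (inj₂ (x , y , x≢y , px , py , fx , fy)) =
    ≤-trans (≤-reflexive (sym (cong₂ _+_ (trans (when-yes (P? x) px) fx)
                                          (trans (when-yes (P? y) py) fy))))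
            (terms≤sumOver _ x≢y (all∈ x) (all∈ y))

-- Relational sums, cardinality and the list of all subsets.

SumP-sumOver : ∀ {P : A → Set} (P? : Decidable P) f xs →
  SumP P f xs (sumOver xs (λ x → f x when P? x))
SumP-sumOver P? f [] = nil
SumP-sumOver P? f (x ∷ xs) with P? x
... | yes px = take px (SumP-sumOver P? f xs)
... | no ¬px = skip ¬px (SumP-sumOver P? f xs)

SumP-functional : ∀ {P : A → Set} {f xs s t} → SumP P f xs s → SumP P f xs t → s ≡ t
SumP-functional nil        nil        = refl
SumP-functional (take _ p)  (take _ q)  = cong (_ +_) (SumP-functional p q)
SumP-functional (take px _) (skip ¬px _) = contradiction px ¬px
SumP-functional (skip ¬px _) (take px _) = contradiction px ¬px
SumP-functional (skip _ p)   (skip _ q)   = SumP-functional p q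

∣p∣≡sumOver : (p : Subset n) → ∣ p ∣ ≡ sumOver (allFin n) (λ v → 1 when (v ∈? p))
∣p∣≡sumOver []      = refl
∣p∣≡sumOver {suc n} (s ∷ p) = trans (head s) (cong ((1 when (zero ∈? (s ∷ p))) +_) tail)
  where
  head : ∀ s → ∣ s ∷ p ∣ ≡ (1 when (zero ∈? (s ∷ p))) + ∣ p ∣
  head inside  = refl
  head outside = refl
  tail : ∣ p ∣ ≡ sumOver (tabulate Fin.suc) (λ v → 1 when (v ∈? (s ∷ p)))
  tail = begin
    -- `suc v ∈? (s ∷ p)` computes to the same truth value as `v ∈? p`, so the induction hypothesis
    -- applies unchanged.
    ∣ p ∣                                                    ≡⟨ ∣p∣≡sumOver p ⟩
    sumOver (allFin n) (λ v → 1 when (suc v ∈? (s ∷ p)))       ≡⟨ sumOver-map _ Fin.suc (allFin n) ⟨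
    sumOver (map Fin.suc (allFin n)) (λ v → 1 when (v ∈? (s ∷ p)))
      ≡⟨ cong (λ xs → sumOver xs (λ v → 1 when (v ∈? (s ∷ p)))) (map-tabulate id Fin.suc) ⟩
    sumOver (tabulate Fin.suc) (λ v → 1 when (v ∈? (s ∷ p)))       ∎
    where open ≡-Reasoning

∈-allSubsets : (p : Subset n) → p List.∈ allSubsets n
∈-allSubsets []            = here refl
∈-allSubsets (inside  ∷ p) = ∈-++⁺ˡ (∈-map⁺ _ (∈-allSubsets p))
∈-allSubsets (outside ∷ p) = ∈-++⁺ʳ _ (∈-map⁺ _ (∈-allSubsets p))

allSubsets-unique : ∀ n → Unique (allSubsets n)
allSubsets-unique zero    = [] ∷ []
allSubsets-unique (suc n) =
  ++⁺ (map⁺ ∷-injectiveʳ (allSubsets-unique n)) (map⁺ ∷-injectiveʳ (allSubsets-unique n)) disjoint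
  where
  disjoint : ∀ {p} → ¬ (p List.∈ map (inside ∷_) (allSubsets n) ×
                        p List.∈ map (outside ∷_) (allSubsets n))
  disjoint (in∈ , out∈) with ∈-map⁻ _ in∈ | ∈-map⁻ _ out∈
  ... | _ , _ , refl | _ , _ , ()

x∉p-x : (x : Fin n) (p : Subset n) → x ∉ p - x
x∉p-x zero    (inside ∷ p)  ()
x∉p-x zero    (outside ∷ p) ()
x∉p-x (suc x) (s ∷ p) (there x∈) = x∉p-x x p x∈

x∈p-y⇒x∈p : ∀ {x y : Fin n} {p} → x ∈ p - y → x ∈ p
x∈p-y⇒x∈p {y = y} {p} = p─q⊆p p ⁅ y ⁆

x∈p-y⇒x≢y : ∀ {x y : Fin n} {p} → x ∈ p - y → x ≢ y
x∈p-y⇒x≢y {p = p} x∈ refl = x∉p-x _ p x∈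

⊈⇒∃∉ : ∀ {S T : Subset n} → ¬ (T ⊆ S) → ∃ λ x → x ∈ T × x ∉ S
⊈⇒∃∉ {S = S} {T} T⊈S with Fin.any? (λ x → x ∈? T ×-dec ¬? (x ∈? S))
... | yes found = found
... | no none = contradiction
  (λ {x} x∈T → decidable-stable (x ∈? S) λ x∉S → none (x , x∈T , x∉S)) T⊈S

delete-mono : ∀ {S T : Subset n} x → S ⊆ T → S - x ⊆ T - x
delete-mono x S⊆T y∈ = x∈p∧x≢y⇒x∈p-y (S⊆T (x∈p-y⇒x∈p y∈)) (x∈p-y⇒x≢y y∈)

-- Reachability in induced subgraphs and its decidability.

module _ {n : ℕ} (G : Graph n) where

  Reach-target : ∀ {S u v} → Reach G S u v → v ∈ S
  Reach-target (here u∈)     = u∈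
  Reach-target (step _ _ v∈) = v∈

  Reach-source : ∀ {S u v} → Reach G S u v → u ∈ S
  Reach-source (here u∈)    = u∈
  Reach-source (step r _ _) = Reach-source r

  Reach-mono : ∀ {S T u v} → S ⊆ T → Reach G S u v → Reach G T u v
  Reach-mono S⊆T (here u∈)     = here (S⊆T u∈)
  Reach-mono S⊆T (step r e v∈) = step (Reach-mono S⊆T r) e (S⊆T v∈)

  Reach-trans : ∀ {S u v w} → Reach G S u v → Reach G S v w → Reach G S u w
  Reach-trans r (here _)      = r
  Reach-trans r (step q e w∈) = step (Reach-trans r q) e w∈

  Reach-edge : ∀ {S u v} → u ∈ S → v ∈ S → E G u v → Reach G S u v
  Reach-edge u∈ v∈ e = step (here u∈) e v∈

  Reach-sym : ∀ {S u v} → Reach G S u v → Reach G S v u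
  Reach-sym (here u∈)     = here u∈
  Reach-sym (step r e v∈) =
    Reach-trans (Reach-edge v∈ (Reach-target r) (E-sym G e)) (Reach-sym r)

  -- Cutting the walk after its last visit to `u` leaves a tail that avoids `u`. Reachability can
  -- therefore be decided by recursion on the smaller set `S - u`.
  Reach-uncons : ∀ {S u v} → Reach G S u v →
    u ≡ v ⊎ ∃ λ w → E G u w × Reach G (S - u) w v
  Reach-uncons (here _) = inj₁ refl
  Reach-uncons {u = u} (step {v = v} r e v∈) with u Fin.≟ v
  ... | yes u≡v = inj₁ u≡v
  ... | no u≢v with Reach-uncons r | x∈p∧x≢y⇒x∈p-y v∈ (u≢v ∘ sym)
  ... | inj₁ refl          | v∈′ = inj₂ (v , e , here v∈′)
  ... | inj₂ (w , e′ , r′) | v∈′ = inj₂ (w , e′ , step r′ e v∈′)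

  Reach? : ∀ S u v → Dec (Reach G S u v)
  Reach? S = search S (⊂-wellFounded S)
    where
    search : ∀ S → Acc _⊂_ S → ∀ u v → Dec (Reach G S u v)
    search S (acc rs) u v with u ∈? S
    ... | no u∉ = no (u∉ ∘ Reach-source)
    ... | yes u∈ with u Fin.≟ v
    ... | yes refl = yes (here u∈)
    ... | no u≢v = map′
      (λ (w , e , r) → let r′ = Reach-mono x∈p-y⇒x∈p r
                       in Reach-trans (Reach-edge u∈ (Reach-source r′) e) r′)
      ([ (λ u≡v → contradiction u≡v u≢v) , id ]′ ∘ Reach-uncons)
      (Fin.any? λ w → adj? G u w ×-dec search (S - u) (rs (x∈p⇒p-x⊂p u∈)) w v)

  Connected? : ∀ S → Dec (Connected G S)
  Connected? S = Fin.all? λ u → Fin.all? λ v → u ∈? S →-dec v ∈? S →-dec Reach? S u v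

  IsCutIn? : ∀ S v → Dec (IsCutIn G S v)
  IsCutIn? S v = v ∈? S ×-dec Fin.any? λ u → Fin.any? λ w →
    u ∈? S ×-dec w ∈? S ×-dec ¬? (u Fin.≟ v) ×-dec ¬? (w Fin.≟ v) ×-dec
    Reach? S u w ×-dec ¬? (Reach? (S - v) u w)

  abstract
    -- Abstract, so that type checking treats the decision as opaque and never unfolds the search
    -- behind it.
    IsCut? : ∀ v → Dec (IsCut G v)
    IsCut? = IsCutIn? ⊤

  -- Biconnected sets, blocks and cliques.

  Biconnected : Subset n → Set
  Biconnected S = Connected G S × NoCutVertex G S

  Biconnected? : ∀ S → Dec (Biconnected S)
  Biconnected? S = Connected? S ×-dec Fin.all? λ v → ¬? (IsCutIn? S v)

  ProperExtension : Subset n → Subset n → Set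
  ProperExtension S T = S ⊆ T × Biconnected T × ¬ (T ⊆ S)

  ProperExtension? : ∀ S T → Dec (ProperExtension S T)
  ProperExtension? S T = S ⊆? T ×-dec Biconnected? T ×-dec ¬? (T ⊆? S)

  maximal : ∀ {S} → ¬ ∃ (ProperExtension S) → ∀ T → S ⊆ T → Connected G T → NoCutVertex G T → T ⊆ S
  maximal {S} none T S⊆T conn nocut =
    decidable-stable (T ⊆? S) λ T⊈S → none (T , S⊆T , (conn , nocut) , T⊈S)

  abstract
    IsBlock? : ∀ H → Dec (IsBlock G H)
    IsBlock? H = map′
      (λ ((conn , nocut) , none) → conn , nocut , maximal none)
      (λ (conn , nocut , max) → (conn , nocut) ,
        λ (T , H⊆T , (connT , nocutT) , T⊈H) → T⊈H (max T H⊆T connT nocutT))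
      (Biconnected? H ×-dec ¬? (anySubset? (ProperExtension? H)))

  -- A biconnected set that is not maximal has a proper biconnected extension, and strict
  -- enlargement within a finite vertex set terminates.
  Biconnected⇒⊆Block : ∀ S → Biconnected S → ∃ λ H → IsBlock G H × S ⊆ H
  Biconnected⇒⊆Block S = extend S (⊃-wellFounded S)
    where
    extend : ∀ S → Acc _⊃_ S → Biconnected S → ∃ λ H → IsBlock G H × S ⊆ H
    extend S (acc rs) (conn , nocut) with anySubset? (ProperExtension? S)
    ... | no none = S , (conn , nocut , maximal none) , id
    ... | yes (T , S⊆T , bicT , T⊈S) =
      let H , block , T⊆H = extend T (rs (S⊆T , ⊈⇒∃∉ T⊈S)) bicT
      in H , block , T⊆H ∘ S⊆T

  hub⇒Connected : ∀ {S} h → (∀ {u} → u ∈ S → Reach G S h u) → Connected G S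
  hub⇒Connected h reach u v u∈ v∈ = Reach-trans (Reach-sym (reach u∈)) (reach v∈)

  deletions⇒NoCutVertex : ∀ {S} → (∀ x → x ∈ S → Connected G (S - x)) → NoCutVertex G S
  deletions⇒NoCutVertex conn x (x∈ , u , w , u∈ , w∈ , u≢x , w≢x , _ , unreachable) =
    unreachable (conn x x∈ u w (x∈p∧x≢y⇒x∈p-y u∈ u≢x) (x∈p∧x≢y⇒x∈p-y w∈ w≢x))

  Clique : Subset n → Set
  Clique S = ∀ u v → u ∈ S → v ∈ S → u ≢ v → E G u v

  Clique⇒Connected : ∀ {S} → Clique S → Connected G S
  Clique⇒Connected clique u v u∈ v∈ with u Fin.≟ v
  ... | yes refl = here u∈
  ... | no u≢v   = Reach-edge u∈ v∈ (clique u v u∈ v∈ u≢v)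

  -- Deleting a vertex from a clique leaves a clique, hence a connected set.
  Clique⇒Biconnected : ∀ {S} → Clique S → Biconnected S
  Clique⇒Biconnected clique = Clique⇒Connected clique , deletions⇒NoCutVertex λ x _ →
    Clique⇒Connected λ u v u∈ v∈ → clique u v (x∈p-y⇒x∈p u∈) (x∈p-y⇒x∈p v∈)

  -- Simple paths and the cycles they close.

  -- The index is the set of visited vertices: it expresses freshness of the next vertex, and with
  -- one more vertex added it is the vertex set of the cycle in `cycle-Biconnected`.
  data SimplePath (a : Fin n) : Subset n → Fin n → Set where
    trivial : SimplePath a ⁅ a ⁆ a
    extend  : ∀ {S b c} → SimplePath a S b → E G b c → c ∉ S → SimplePath a (S ∪ ⁅ c ⁆) c

  SimplePath-target : ∀ {a S b} → SimplePath a S b → b ∈ S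
  SimplePath-target trivial                  = x∈⁅x⁆ _
  SimplePath-target (extend {S} {c = c} _ _ _) = q⊆p∪q S ⁅ c ⁆ (x∈⁅x⁆ c)

  SimplePath-prefix : ∀ {a S b c} → SimplePath a S b → c ∈ S → ∃ λ T → T ⊆ S × SimplePath a T c
  SimplePath-prefix {a} trivial c∈ with refl ← x∈⁅y⁆⇒x≡y a c∈ = ⁅ a ⁆ , id , trivial
  SimplePath-prefix (extend {S} {c = d} p e d∉) c∈ with x∈p∪q⁻ S ⁅ d ⁆ c∈
  ... | inj₁ c∈S = let T , T⊆S , q = SimplePath-prefix p c∈S in T , p⊆p∪q ⁅ d ⁆ ∘ T⊆S , q
  ... | inj₂ c∈d with refl ← x∈⁅y⁆⇒x≡y d c∈d = S ∪ ⁅ d ⁆ , id , extend p e d∉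

  -- Whenever the walk returns to a vertex already on the path, the path is cut back to its prefix
  -- ending there.
  Reach⇒SimplePath : ∀ {S a b} → Reach G S a b → ∃ λ T → T ⊆ S × SimplePath a T b
  Reach⇒SimplePath {S} {a} (here a∈) =
    ⁅ a ⁆ , (λ x∈ → subst (_∈ S) (sym (x∈⁅y⁆⇒x≡y a x∈)) a∈) , trivial
  Reach⇒SimplePath {S} (step {v = v} r e v∈) with Reach⇒SimplePath r
  ... | T , T⊆S , p with v ∈? T
  ... | yes v∈T = let T′ , T′⊆T , q = SimplePath-prefix p v∈T in T′ , T⊆S ∘ T′⊆T , q
  ... | no v∉T = T ∪ ⁅ v ⁆ ,
    [ T⊆S , (λ x∈ → subst (_∈ S) (sym (x∈⁅y⁆⇒x≡y v x∈)) v∈) ]′ ∘ x∈p∪q⁻ T ⁅ v ⁆ , extend p e v∉T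

  SimplePath⇒Reach : ∀ {a S b} → SimplePath a S b → ∀ {y} → y ∈ S → Reach G S a y
  SimplePath⇒Reach {a} trivial y∈ with refl ← x∈⁅y⁆⇒x≡y a y∈ = here y∈
  SimplePath⇒Reach (extend {S} {c = c} p e _) y∈ with x∈p∪q⁻ S ⁅ c ⁆ y∈
  ... | inj₁ y∈S = Reach-mono (p⊆p∪q ⁅ c ⁆) (SimplePath⇒Reach p y∈S)
  ... | inj₂ y∈c with refl ← x∈⁅y⁆⇒x≡y c y∈c =
    step (Reach-mono (p⊆p∪q ⁅ c ⁆) (SimplePath⇒Reach p (SimplePath-target p))) e y∈

  -- Deleting `x` splits the path into at most two pieces, and each of them keeps one of the ends
  -- `a` and `b`.
  SimplePath-delete : ∀ {a S b} → SimplePath a S b → ∀ {x y} → x ∈ S → y ∈ S - x →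
    Reach G (S - x) a y ⊎ Reach G (S - x) b y
  SimplePath-delete {a} trivial {x} x∈ y∈
    with refl ← x∈⁅y⁆⇒x≡y a x∈ | refl ← x∈⁅y⁆⇒x≡y a (x∈p-y⇒x∈p y∈) =
    contradiction refl (x∈p-y⇒x≢y y∈)
  SimplePath-delete (extend {S} {c = c} p e c∉) {x} x∈ y∈
    with x∈p∪q⁻ S ⁅ c ⁆ x∈ | x∈p∪q⁻ S ⁅ c ⁆ (x∈p-y⇒x∈p y∈)
  ... | _ | inj₂ y∈c with refl ← x∈⁅y⁆⇒x≡y c y∈c = inj₂ (here y∈)
  -- The deleted vertex is the last one, so the shorter path avoids it entirely.
  SimplePath-delete (extend {S} {c = c} p e c∉) {x} {y} x∈ y∈
      | inj₂ x∈c | inj₁ y∈S with refl ← x∈⁅y⁆⇒x≡y c x∈c =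
    inj₁ (Reach-mono (λ z∈ → x∈p∧x≢y⇒x∈p-y (p⊆p∪q ⁅ c ⁆ z∈) λ { refl → c∉ z∈ }) (SimplePath⇒Reach p y∈S))
  SimplePath-delete (extend {S} {c = c} p e c∉) {x} {y} x∈ y∈
      | inj₁ x∈S | inj₁ y∈S
    with SimplePath-delete p x∈S (x∈p∧x≢y⇒x∈p-y y∈S (x∈p-y⇒x≢y y∈))
  ... | inj₁ r = inj₁ (Reach-mono (delete-mono x (p⊆p∪q ⁅ c ⁆)) r)
  -- The piece at the old endpoint is attached to the new endpoint `c` by the last edge.
  ... | inj₂ r =
    let r′ = Reach-mono (delete-mono x (p⊆p∪q ⁅ c ⁆)) r
        c∈ = x∈p∧x≢y⇒x∈p-y (q⊆p∪q S ⁅ c ⁆ (x∈⁅x⁆ c)) λ { refl → c∉ x∈S }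
    in inj₂ (Reach-trans (Reach-edge c∈ (Reach-source r′) (E-sym G e)) r′)

  -- Without `v` the path itself remains and is connected from `a`. Without a path vertex, every
  -- remaining piece still contains `a` or `b`, and both are adjacent to `v`.
  cycle-Biconnected : ∀ {a S b v} → SimplePath a S b → E G v a → E G v b → v ∉ S →
    Biconnected (S ∪ ⁅ v ⁆)
  cycle-Biconnected {a} {S} {b} {v} p va vb v∉ = hub⇒Connected v spokes , deletions⇒NoCutVertex deletion
    where
    S⊆ : S ⊆ S ∪ ⁅ v ⁆
    S⊆ = p⊆p∪q ⁅ v ⁆
    v∈ : v ∈ S ∪ ⁅ v ⁆
    v∈ = q⊆p∪q S ⁅ v ⁆ (x∈⁅x⁆ v)
    via : ∀ {T c u} → v ∈ T → E G v c → Reach G T c u → Reach G T v u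
    via v∈T e r = Reach-trans (Reach-edge v∈T (Reach-source r) e) r
    spokes : ∀ {u} → u ∈ S ∪ ⁅ v ⁆ → Reach G (S ∪ ⁅ v ⁆) v u
    spokes u∈ with x∈p∪q⁻ S ⁅ v ⁆ u∈
    ... | inj₁ u∈S = via v∈ va (Reach-mono S⊆ (SimplePath⇒Reach p u∈S))
    ... | inj₂ u∈v with refl ← x∈⁅y⁆⇒x≡y v u∈v = here v∈
    deletion : ∀ x → x ∈ S ∪ ⁅ v ⁆ → Connected G (S ∪ ⁅ v ⁆ - x)
    deletion x x∈ with x∈p∪q⁻ S ⁅ v ⁆ x∈
    ... | inj₂ x∈v with refl ← x∈⁅y⁆⇒x≡y v x∈v = hub⇒Connected a reach
      where
      reach : ∀ {u} → u ∈ S ∪ ⁅ v ⁆ - v → Reach G (S ∪ ⁅ v ⁆ - v) a u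
      reach u∈ with x∈p∪q⁻ S ⁅ v ⁆ (x∈p-y⇒x∈p u∈)
      ... | inj₁ u∈S =
        Reach-mono (λ z∈ → x∈p∧x≢y⇒x∈p-y (S⊆ z∈) λ { refl → v∉ z∈ }) (SimplePath⇒Reach p u∈S)
      ... | inj₂ u∈v = contradiction (x∈⁅y⁆⇒x≡y v u∈v) (x∈p-y⇒x≢y u∈)
    deletion x x∈ | inj₁ x∈S = hub⇒Connected v reach
      where
      v∈′ : v ∈ S ∪ ⁅ v ⁆ - x
      v∈′ = x∈p∧x≢y⇒x∈p-y v∈ λ { refl → v∉ x∈S }
      reach : ∀ {u} → u ∈ S ∪ ⁅ v ⁆ - x → Reach G (S ∪ ⁅ v ⁆ - x) v u
      reach u∈ with x∈p∪q⁻ S ⁅ v ⁆ (x∈p-y⇒x∈p u∈)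
      ... | inj₂ u∈v with refl ← x∈⁅y⁆⇒x≡y v u∈v = here v∈′
      ... | inj₁ u∈S with SimplePath-delete p x∈S (x∈p∧x≢y⇒x∈p-y u∈S (x∈p-y⇒x≢y u∈))
      ... | inj₁ r = via v∈′ va (Reach-mono (delete-mono x S⊆) r)
      ... | inj₂ r = via v∈′ vb (Reach-mono (delete-mono x S⊆) r)

  -- Block types in terms of the number of non-cut vertices.

  NonCutIn? : ∀ H v → Dec (v ∈ H × ¬ IsCut G v)
  NonCutIn? H v = v ∈? H ×-dec ¬? (IsCut? v)

  CutIn? : ∀ H v → Dec (v ∈ H × IsCut G v)
  CutIn? H v = v ∈? H ×-dec IsCut? v

  nonCutSum : (Fin n → ℕ) → Subset n → ℕ
  nonCutSum f H = sumOver (allFin n) λ v → f v when NonCutIn? H v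

  cutSum : (Fin n → ℕ) → Subset n → ℕ
  cutSum f H = sumOver (allFin n) λ v → f v when CutIn? H v

  nonCutCount : Subset n → ℕ
  nonCutCount = nonCutSum λ _ → 1

  cutSum+nonCutSum : ∀ f H → sumOver (allFin n) (λ v → f v when (v ∈? H)) ≡ cutSum f H + nonCutSum f H
  cutSum+nonCutSum f H = trans
    (sumOver-cong (λ v → when-split (f v) (v ∈? H) (IsCut? v)) (allFin n))
    (sumOver-+ (λ v → f v when CutIn? H v) (λ v → f v when NonCutIn? H v) (allFin n))

  NumCutIn-cutSum : ∀ H → NumCutIn G H (cutSum (λ _ → 1) H)
  NumCutIn-cutSum H = SumP-sumOver (CutIn? H) _ (allFin n)

  -- The relational count has only one value. Cancelling it turns types 0, 1 and 2 into
  -- `nonCutCount H` being 0, being 1 and being at least 2.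
  NumCutIn⇒∣H∣ : ∀ {H c} → NumCutIn G H c → ∣ H ∣ ≡ c + nonCutCount H
  NumCutIn⇒∣H∣ {H} num = begin
    ∣ H ∣                                               ≡⟨ ∣p∣≡sumOver H ⟩
    sumOver (allFin n) (λ v → 1 when (v ∈? H))          ≡⟨ cutSum+nonCutSum (λ _ → 1) H ⟩
    cutSum (λ _ → 1) H + nonCutCount H
      ≡⟨ cong (_+ nonCutCount H) (SumP-functional (NumCutIn-cutSum H) num) ⟩
    _ + nonCutCount H                                   ∎
    where open ≡-Reasoning

  Type0⇒count : ∀ {H} → Type0 G H → nonCutCount H ≡ 0
  Type0⇒count (c , num , eq) =
    +-cancelˡ-≡ c _ _ (trans (sym (NumCutIn⇒∣H∣ num)) (trans eq (sym (+-identityʳ c))))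

  Type1⇒count : ∀ {H} → Type1 G H → nonCutCount H ≡ 1
  Type1⇒count (c , num , eq) =
    +-cancelˡ-≡ c _ _ (trans (sym (NumCutIn⇒∣H∣ num)) (trans eq (+-comm 1 c)))

  Type2⇒count : ∀ {H} → Type2 G H → 2 ≤ nonCutCount H
  Type2⇒count (c , num , le) =
    +-cancelˡ-≤ c _ _ (≤-trans (≤-reflexive (+-comm c 2)) (≤-trans le (≤-reflexive (NumCutIn⇒∣H∣ num))))

  types : ∀ H → Type0 G H ⊎ Type1 G H ⊎ Type2 G H
  types H with nonCutCount H | NumCutIn⇒∣H∣ (NumCutIn-cutSum H)
  ... | zero        | card = inj₁ (_ , NumCutIn-cutSum H , trans card (+-identityʳ _))
  ... | suc zero    | card = inj₂ (inj₁ (_ , NumCutIn-cutSum H , trans card (+-comm _ 1)))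
  ... | suc (suc k) | card = inj₂ (inj₂ (_ , NumCutIn-cutSum H , ≤-trans
    (≤-reflexive (+-comm 2 _))
    (≤-trans (+-monoʳ-≤ _ (s≤s (s≤s z≤n))) (≤-reflexive (sym card)))))

  nonCut⇒count≥1 : ∀ {H v} → v ∈ H → ¬ IsCut G v → 1 ≤ nonCutCount H
  nonCut⇒count≥1 {H} {v} v∈ ¬cut = ≤-trans
    (≤-reflexive (sym (when-yes (NonCutIn? H v) (v∈ , ¬cut))))
    (term≤sumOver (λ v → 1 when NonCutIn? H v) (∈-allFin v))

  nonCut⇒¬Type0 : ∀ {H v} → v ∈ H → ¬ IsCut G v → ¬ Type0 G H
  nonCut⇒¬Type0 v∈ ¬cut t0 = >⇒≢ (nonCut⇒count≥1 v∈ ¬cut) (Type0⇒count t0)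

  count≥1⇒nonCut : ∀ {H} → 1 ≤ nonCutCount H → ∃ λ v → v ∈ H × ¬ IsCut G v
  count≥1⇒nonCut {H} le =
    let v , _ , pos = sumOver≥1 _ (allFin n) le in v , proj₁ (when-positive 0 (NonCutIn? H v) pos)

  Type1⇒nonCut : ∀ {H} → Type1 G H → ∃ λ v → v ∈ H × ¬ IsCut G v
  Type1⇒nonCut t1 = count≥1⇒nonCut (≤-reflexive (sym (Type1⇒count t1)))

  -- Two different non-cut vertices would contribute 1 + 1 to the count.
  count≡1⇒unique : ∀ {H v w} → nonCutCount H ≡ 1 → v ∈ H → ¬ IsCut G v → w ∈ H → ¬ IsCut G w → v ≡ w
  count≡1⇒unique {H} {v} {w} one v∈ ¬cutv w∈ ¬cutw with v Fin.≟ w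
  ... | yes v≡w = v≡w
  ... | no v≢w  = contradiction
    (subst₂ _≤_
      (cong₂ _+_ (when-yes (NonCutIn? H v) (v∈ , ¬cutv)) (when-yes (NonCutIn? H w) (w∈ , ¬cutw))) one
      (terms≤sumOver (λ v → 1 when NonCutIn? H v) v≢w (∈-allFin v) (∈-allFin w)))
    λ { (s≤s ()) }

  -- Applied with `c` the label of the only non-cut vertex in type 1, with 0 where all labels
  -- vanish, and with `g (inj₂ H)` for the function pulled back from T_G.
  nonCutSum-constant : ∀ f {H} c → (∀ v → v ∈ H → ¬ IsCut G v → f v ≡ c) →
    nonCutSum f H ≡ nonCutCount H * c
  nonCutSum-constant f {H} c const = trans
    (sumOver-cong (λ v → when-scale c (NonCutIn? H v) λ (v∈ , ¬cut) → const v v∈ ¬cut) (allFin n))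
    (sumOver-* (λ v → 1 when NonCutIn? H v) c (allFin n))

  nonCutSum-zero : ∀ f {H} → (∀ v → v ∈ H → ¬ IsCut G v → f v ≡ 0) → nonCutSum f H ≡ 0
  nonCutSum-zero f {H} zeros = trans (nonCutSum-constant f 0 zeros) (*-zeroʳ (nonCutCount H))

  -- Vertices of T_G, and blocks through a vertex or an edge.

  IsTV? : ∀ x → Dec (IsTV G x)
  IsTV? (inj₁ v) = IsCut? v
  IsTV? (inj₂ H) = IsBlock? H

  -- The endpoints form a clique, which extends to a block. Allowing `u ≡ v` also provides a block
  -- through a single vertex.
  close⇒∃Block : ∀ u v → u ≡ v ⊎ E G u v → ∃ λ H → IsBlock G H × u ∈ H × v ∈ H
  close⇒∃Block u v close =
    let H , block , ⊆H = Biconnected⇒⊆Block (⁅ u ⁆ ∪ ⁅ v ⁆) (Clique⇒Biconnected clique)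
    in H , block , ⊆H (p⊆p∪q ⁅ v ⁆ (x∈⁅x⁆ u)) , ⊆H (q⊆p∪q ⁅ u ⁆ ⁅ v ⁆ (x∈⁅x⁆ v))
    where
    edge : u ≢ v → E G u v
    edge u≢v = [ (λ u≡v → contradiction u≡v u≢v) , id ]′ close
    endpoint : ∀ {x} → x ∈ ⁅ u ⁆ ∪ ⁅ v ⁆ → x ≡ u ⊎ x ≡ v
    endpoint = Sum.map (x∈⁅y⁆⇒x≡y u) (x∈⁅y⁆⇒x≡y v) ∘ x∈p∪q⁻ ⁅ u ⁆ ⁅ v ⁆
    clique : Clique (⁅ u ⁆ ∪ ⁅ v ⁆)
    clique x y x∈ y∈ x≢y with endpoint x∈ | endpoint y∈
    ... | inj₁ refl | inj₁ refl = contradiction refl x≢y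
    ... | inj₁ refl | inj₂ refl = edge x≢y
    ... | inj₂ refl | inj₁ refl = E-sym G (edge (x≢y ∘ sym))
    ... | inj₂ refl | inj₂ refl = contradiction refl x≢y

  abstract
    -- An arbitrary choice when `v` is a cut-vertex; in a block graph `nonCut-blockAt` shows that
    -- there is no choice for the other vertices.
    blockAt : Fin n → Subset n
    blockAt v = proj₁ (close⇒∃Block v v (inj₁ refl))

    blockAt-IsBlock : ∀ v → IsBlock G (blockAt v)
    blockAt-IsBlock v = proj₁ (proj₂ (close⇒∃Block v v (inj₁ refl)))

    ∈-blockAt : ∀ v → v ∈ blockAt v
    ∈-blockAt v = proj₁ (proj₂ (proj₂ (close⇒∃Block v v (inj₁ refl))))

  -- Uniqueness of the block of a non-cut vertex.

  module _ (blockGraph : IsBlockGraph G) where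

    nonCut-neighbours : ∀ {v a b} → ¬ IsCut G v → E G v a → E G v b → a ≢ b → E G a b
    nonCut-neighbours {v} {a} {b} ¬cut va vb a≢b =
      let S , S⊆ , p = Reach⇒SimplePath reachable
          v∉S        = λ v∈S → x∉p-x v ⊤ (S⊆ v∈S)
          H , block , ⊆H = Biconnected⇒⊆Block (S ∪ ⁅ v ⁆) (cycle-Biconnected p va vb v∉S)
      in blockGraph H block a b
           (⊆H (p⊆p∪q ⁅ v ⁆ (Reach-source (SimplePath⇒Reach p (SimplePath-target p)))))
           (⊆H (p⊆p∪q ⁅ v ⁆ (SimplePath-target p))) a≢b
      where
      neighbour≢ : ∀ {u} → E G v u → u ≢ v
      neighbour≢ vu refl = irrefl G vu
      reachable : Reach G (⊤ - v) a b
      -- The walk from `a` through `v` to `b` joins the two in `G`, so if they were separated in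
      -- `⊤ - v`, then `v` would be a cut-vertex.
      reachable = decidable-stable (Reach? (⊤ - v) a b) λ unreachable → ¬cut
        (∈⊤ , a , b , ∈⊤ , ∈⊤ , neighbour≢ va , neighbour≢ vb ,
         step (Reach-edge ∈⊤ ∈⊤ (E-sym G va)) vb ∈⊤ , unreachable)

    nonCut-⊆ : ∀ {v H K} → ¬ IsCut G v → IsBlock G H → v ∈ H → IsBlock G K → v ∈ K → K ⊆ H
    nonCut-⊆ {v} {H} {K} ¬cut bH@(_ , _ , max) v∈H bK v∈K =
      let conn , nocut = Clique⇒Biconnected clique
      in max (H ∪ K) (p⊆p∪q K) conn nocut ∘ q⊆p∪q H K
      where
      -- Only pairs from different blocks are new. Either one member is `v`, and the pair lies in a
      -- single block, or both are neighbours of `v`.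
      across : ∀ x y → x ∈ H → y ∈ K → x ≢ y → E G x y
      across x y x∈ y∈ x≢y with x Fin.≟ v | y Fin.≟ v
      ... | yes refl | _        = blockGraph K bK x y v∈K y∈ x≢y
      ... | no _     | yes refl = blockGraph H bH x y x∈ v∈H x≢y
      ... | no x≢v   | no y≢v   = nonCut-neighbours ¬cut
        (blockGraph H bH v x v∈H x∈ (x≢v ∘ sym)) (blockGraph K bK v y v∈K y∈ (y≢v ∘ sym)) x≢y
      clique : Clique (H ∪ K)
      clique x y x∈ y∈ x≢y with x∈p∪q⁻ H K x∈ | x∈p∪q⁻ H K y∈
      ... | inj₁ xH | inj₁ yH = blockGraph H bH x y xH yH x≢y
      ... | inj₁ xH | inj₂ yK = across x y xH yK x≢y
      ... | inj₂ xK | inj₁ yH = E-sym G (across y x yH xK (x≢y ∘ sym))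
      ... | inj₂ xK | inj₂ yK = blockGraph K bK x y xK yK x≢y

    nonCut-blockAt : ∀ {v H} → ¬ IsCut G v → IsBlock G H → v ∈ H → blockAt v ≡ H
    nonCut-blockAt {v} ¬cut block v∈ = ⊆-antisym
      (nonCut-⊆ ¬cut block v∈ (blockAt-IsBlock v) (∈-blockAt v))
      (nonCut-⊆ ¬cut (blockAt-IsBlock v) (∈-blockAt v) block v∈)

    -- Some block contains the edge, and it has to be the only block through `v`.
    nonCut-neighbour-∈ : ∀ {v u H} → ¬ IsCut G v → IsBlock G H → v ∈ H → E G v u → u ∈ H
    nonCut-neighbour-∈ {v} {u} {H} ¬cut block v∈ e =
      let K , blockK , v∈K , u∈K = close⇒∃Block v u (inj₂ e)
      in nonCut-⊆ ¬cut block v∈ blockK v∈K u∈K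

    -- Equality of the weights on `G` and T_G.

    -- Double counting of pairs of a block and a non-cut vertex in it. The hypotheses on `f` and `g`
    -- are what the two directions of the theorem have in common.
    weight-TV : ∀ {f g} → (∀ v → IsCut G v → g (inj₁ v) ≡ f v) →
      (∀ H → IsBlock G H → g (inj₂ H) ≡ nonCutSum f H) →
      SumP (IsTV G) g (allTV G) (weight G f)
    weight-TV {f} {g} cut block = subst (SumP (IsTV G) g (allTV G)) total (SumP-sumOver IsTV? g (allTV G))
      where
      open ≡-Reasoning

      inBlock : Fin n → Subset n → ℕ
      inBlock v H = (f v when NonCutIn? H v) when IsBlock? H

      cuts blocks : ℕ
      cuts   = sumOver (allFin n) λ v → f v when IsCut? v
      blocks = sumOver (allFin n) λ v → f v when ¬? (IsCut? v)

      -- A cut-vertex is filtered out in every block; any other vertex is counted once, at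
      -- `blockAt v`.
      inBlock-total : ∀ v → Dec (IsCut G v) →
        sumOver (allSubsets n) (inBlock v) ≡ f v when ¬? (IsCut? v)
      inBlock-total v (yes cutv) = trans
        (sumOver-zero (All.universal (λ H → trans
          (when-cong (IsBlock? H) λ _ → when-no (NonCutIn? H v) λ (_ , ¬cutv) → ¬cutv cutv)
          (when-zero (IsBlock? H))) (allSubsets n)))
        (sym (when-no (¬? (IsCut? v)) λ ¬cutv → ¬cutv cutv))
      inBlock-total v (no ¬cutv) = begin
        sumOver (allSubsets n) (inBlock v)
          ≡⟨ sumOver-single (allSubsets-unique n) (∈-allSubsets (blockAt v)) elsewhere ⟩
        inBlock v (blockAt v)           ≡⟨ when-yes (IsBlock? (blockAt v)) (blockAt-IsBlock v) ⟩
        f v when NonCutIn? (blockAt v) v ≡⟨ when-yes (NonCutIn? (blockAt v) v) (∈-blockAt v , ¬cutv) ⟩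
        f v                             ≡⟨ when-yes (¬? (IsCut? v)) ¬cutv ⟨
        f v when ¬? (IsCut? v)          ∎
        where
        elsewhere : ∀ H → H ≢ blockAt v → inBlock v H ≡ 0
        elsewhere H H≢ = trans
          (when-cong (IsBlock? H) λ block → when-no (NonCutIn? H v) λ (v∈ , _) →
            H≢ (sym (nonCut-blockAt ¬cutv block v∈)))
          (when-zero (IsBlock? H))

      total : sumOver (allTV G) (λ x → g x when IsTV? x) ≡ weight G f
      total = begin
        sumOver (allTV G) (λ x → g x when IsTV? x)
          ≡⟨ sumOver-++ _ (map inj₁ (allFin n)) _ ⟩
        sumOver (map inj₁ (allFin n)) (λ x → g x when IsTV? x)
          + sumOver (map inj₂ (allSubsets n)) (λ x → g x when IsTV? x)
          ≡⟨ cong₂ _+_ (sumOver-map _ inj₁ (allFin n)) (sumOver-map _ inj₂ (allSubsets n)) ⟩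
        sumOver (allFin n) (λ v → g (inj₁ v) when IsCut? v)
          + sumOver (allSubsets n) (λ H → g (inj₂ H) when IsBlock? H)
          ≡⟨ cong₂ _+_ (sumOver-cong (λ v → when-cong (IsCut? v) (cut v)) (allFin n))
                       (sumOver-cong (λ H → trans (when-cong (IsBlock? H) (block H))
                                                  (sumOver-when _ (allFin n) (IsBlock? H))) (allSubsets n)) ⟩
        cuts + sumOver (allSubsets n) (λ H → sumOver (allFin n) (λ v → inBlock v H))
          -- Exchanging the sums groups the terms by vertex instead of by block.
          ≡⟨ cong (cuts +_) (sumOver-swap (λ H v → inBlock v H) (allSubsets n) (allFin n)) ⟩
        cuts + sumOver (allFin n) (λ v → sumOver (allSubsets n) (inBlock v))
          ≡⟨ cong (cuts +_) (sumOver-cong (λ v → inBlock-total v (IsCut? v)) (allFin n)) ⟩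
        cuts + blocks
          ≡⟨ sumOver-+ (λ v → f v when IsCut? v) (λ v → f v when ¬? (IsCut? v)) (allFin n) ⟨
        sumOver (allFin n) (λ v → (f v when IsCut? v) + (f v when ¬? (IsCut? v)))
          ≡⟨ sumOver-cong (λ v → when-complement (f v) (IsCut? v)) (allFin n) ⟩
        weight G f ∎

    -- The vertex of T_G that carries the label of v.
    carrier : Fin n → TV G
    carrier v = if does (IsCut? v) then inj₁ v else inj₂ (blockAt v)

    carrier-cut : ∀ {v} → IsCut G v → carrier v ≡ inj₁ v
    carrier-cut {v} cutv with IsCut? v
    ... | yes _    = refl
    ... | no ¬cutv = contradiction cutv ¬cutv

    carrier-nonCut : ∀ {v H} → ¬ IsCut G v → IsBlock G H → v ∈ H → carrier v ≡ inj₂ H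
    carrier-nonCut {v} ¬cutv block v∈ with IsCut? v
    ... | yes cutv = contradiction cutv ¬cutv
    ... | no _     = cong inj₂ (nonCut-blockAt ¬cutv block v∈)

    carrier-IsTV : ∀ v → IsTV G (carrier v)
    carrier-IsTV v with IsCut? v
    ... | yes cutv = cutv
    ... | no _     = blockAt-IsBlock v

    -- Adjacency in `G` and distance at most 2 in T_G.

    Near : Fin n → TV G → Set
    Near v u = IsTV G u × u ≢ inj₁ v × Dist≤2 G (inj₁ v) u

    -- A cut neighbour is at distance 2 through a block containing the edge. A non-cut neighbour
    -- lies in one block only, which then contains `v` and is at distance 1.
    neighbour⇒Near : ∀ {v u} → IsCut G v → E G v u → Near v (carrier u)
    neighbour⇒Near {v} {u} cutv e with IsCut? u
    ... | yes cutu =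
      let H , block , v∈ , u∈ = close⇒∃Block v u (inj₂ e)
      in cutu , (λ { refl → irrefl G e }) ,
         inj₂ (inj₂ (inj₂ H , (cutv , block , v∈) , (cutu , block , u∈)))
    ... | no ¬cutu =
      blockAt-IsBlock u , (λ ()) ,
      inj₂ (inj₁ (cutv , blockAt-IsBlock u ,
                  nonCut-neighbour-∈ ¬cutu (blockAt-IsBlock u) (∈-blockAt u) (E-sym G e)))

    -- T_G is bipartite, so two different cut-vertices within distance 2 share a block, and that
    -- block is complete.
    near-cut⇒neighbour : ∀ {v u} → inj₁ u ≢ inj₁ v → Dist≤2 G (inj₁ v) (inj₁ u) → IsCut G u × E G v u
    near-cut⇒neighbour u≢v (inj₁ eq) = contradiction (sym eq) u≢v
    near-cut⇒neighbour {v} {u} u≢v (inj₂ (inj₂ (inj₂ H , (_ , block , v∈) , (cutu , _ , u∈)))) =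
      cutu , blockGraph H block v u v∈ u∈ λ { refl → u≢v refl }

    -- By bipartiteness, a block within distance 2 of a cut-vertex is at distance 1.
    near-block⇒∈ : ∀ {v H} → Dist≤2 G (inj₁ v) (inj₂ H) → IsBlock G H × v ∈ H
    near-block⇒∈ (inj₂ (inj₁ (_ , block , v∈)))   = block , v∈
    near-block⇒∈ (inj₂ (inj₂ (inj₁ _ , () , _)))
    near-block⇒∈ (inj₂ (inj₂ (inj₂ _ , _ , ())))

    -- From the R2DF on `G` to the labelling of T_G.

    module _ {γ g} (conditions : CondA G γ g) where
      private
        f     = proj₁ conditions
        r2df  = proj₁ (proj₂ conditions)
        f≤2   = proj₁ r2df
        dom   = proj₂ r2df
        wt    = proj₁ (proj₂ (proj₂ conditions))
        L1    = proj₁ (proj₂ (proj₂ (proj₂ conditions)))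
        L2    = proj₁ (proj₂ (proj₂ (proj₂ (proj₂ conditions))))
        onCut = proj₁ (proj₂ (proj₂ (proj₂ (proj₂ (proj₂ conditions)))))
        onBlock = proj₂ (proj₂ (proj₂ (proj₂ (proj₂ (proj₂ conditions)))))

      -- Cancelling `b` stands in for the subtraction: both relational sums have unique values, and
      -- the part left over is the sum over the non-cut vertices.
      block-label : ∀ H → IsBlock G H → g (inj₂ H) ≡ nonCutSum f H
      block-label H block with onBlock H block
      ... | a , b , sumA , sumB , eq = +-cancelʳ-≡ b _ _ (begin
        g (inj₂ H) + b                                ≡⟨ eq ⟩
        a                                             ≡⟨ SumP-functional sumA (SumP-sumOver (_∈? H) f (allFin n)) ⟩
        sumOver (allFin n) (λ v → f v when (v ∈? H))  ≡⟨ cutSum+nonCutSum f H ⟩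
        cutSum f H + nonCutSum f H
          ≡⟨ cong (_+ nonCutSum f H) (SumP-functional (SumP-sumOver (CutIn? H) f (allFin n)) sumB) ⟩
        b + nonCutSum f H                             ≡⟨ +-comm b _ ⟩
        nonCutSum f H + b                             ∎)
        where open ≡-Reasoning

      -- In type 1, `v` is the only summand of `nonCutSum f H`; in type 2, L2 makes both sides 0; in
      -- type 0 there is no such `v`.
      nonCut-label : ∀ {v H} → ¬ IsCut G v → IsBlock G H → v ∈ H → g (inj₂ H) ≡ f v
      nonCut-label {v} {H} ¬cutv block v∈ = trans (block-label H block) (byType (types H))
        where
        byType : Type0 G H ⊎ Type1 G H ⊎ Type2 G H → nonCutSum f H ≡ f v
        byType (inj₁ t0) = contradiction t0 (nonCut⇒¬Type0 v∈ ¬cutv)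
        byType (inj₂ (inj₁ t1)) = begin
          nonCutSum f H
            ≡⟨ nonCutSum-constant f (f v) (λ w w∈ ¬cutw → cong f
                 (count≡1⇒unique (Type1⇒count t1) w∈ ¬cutw v∈ ¬cutv)) ⟩
          nonCutCount H * f v  ≡⟨ cong (_* f v) (Type1⇒count t1) ⟩
          1 * f v              ≡⟨ *-identityˡ (f v) ⟩
          f v                  ∎
          where open ≡-Reasoning
        byType (inj₂ (inj₂ t2)) =
          trans (nonCutSum-zero f (L2 H block t2)) (sym (L2 H block t2 v v∈ ¬cutv))

      carrier-label : ∀ v → g (carrier v) ≡ f v
      carrier-label v with IsCut? v
      ... | yes cutv = onCut v cutv
      ... | no ¬cutv = nonCut-label ¬cutv (blockAt-IsBlock v) (∈-blockAt v)

      -- Only a block of type 2 carries several vertices, and L2 makes these zero.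
      carrier-injective : ∀ {u w} → 1 ≤ f u → carrier u ≡ carrier w → u ≡ w
      carrier-injective {u} {w} pos eq with IsCut? u | IsCut? w
      ... | yes _ | yes _ = inj₁-injective eq
      ... | no ¬cutu | no ¬cutw = byType (types (blockAt u))
        where
        w∈ : w ∈ blockAt u
        w∈ = subst (w ∈_) (sym (inj₂-injective eq)) (∈-blockAt w)
        byType : Type0 G (blockAt u) ⊎ Type1 G (blockAt u) ⊎ Type2 G (blockAt u) → u ≡ w
        byType (inj₁ t0) =
          contradiction t0 (nonCut⇒¬Type0 (∈-blockAt u) ¬cutu)
        byType (inj₂ (inj₁ t1)) = count≡1⇒unique (Type1⇒count t1) (∈-blockAt u) ¬cutu w∈ ¬cutw
        byType (inj₂ (inj₂ t2)) =
          contradiction (L2 _ (blockAt-IsBlock u) t2 u (∈-blockAt u) ¬cutu) (>⇒≢ pos)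

      protected : ∀ v → f v ≡ 0 → Two (E G v) f
      protected v fv = sumOver≥2⇒Two (adj? G v) (allFin⁺ n) f≤2 (dom v fv)

      near-protected : ∀ v → IsCut G v → f v ≡ 0 → Two (Near v) g
      -- Positivity belongs to the relation because `carrier` is injective only on vertices of
      -- positive label.
      near-protected v cutv fv = Two-map (λ u x → 1 ≤ f u × carrier u ≡ x)
        (λ u e pos → carrier u , neighbour⇒Near cutv e , carrier-label u , pos , refl)
        (λ { (pos , eq) (_ , eq′) → carrier-injective pos (trans eq (sym eq′)) })
        (protected v fv)

      -- A non-cut vertex `v` of `H` has label 0, and all its neighbours lie in `H`. The non-cut
      -- ones among them share the label 0, so `v` is protected by cut-vertices of `H`.
      block-protected : ∀ H → IsBlock G H → 1 ≤ nonCutCount H → g (inj₂ H) ≡ 0 → Two (TAdj G (inj₂ H)) g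
      block-protected H block count≥1 gH =
        let v , v∈ , ¬cutv = count≥1⇒nonCut count≥1
        in Two-map (λ u x → inj₁ u ≡ x)
             (λ u e pos → send u (nonCut-neighbour-∈ ¬cutv block v∈ e) pos (IsCut? u))
             (λ { refl refl → refl })
             (protected v (trans (sym (nonCut-label ¬cutv block v∈)) gH))
        where
        send : ∀ u → u ∈ H → 1 ≤ f u → Dec (IsCut G u) →
          ∃ λ x → TAdj G (inj₂ H) x × g x ≡ f u × inj₁ u ≡ x
        send u u∈ pos (yes cutu) = inj₁ u , (cutu , block , u∈) , onCut u cutu , refl
        send u u∈ pos (no ¬cutu) =
          contradiction (trans (sym (nonCut-label ¬cutu block u∈)) gH) (>⇒≢ pos)

      CondA⇒CondB : CondB G γ g
      CondA⇒CondB = cond1 , cond2 , cond3 , cond4 ,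
        subst (SumP (IsTV G) g (allTV G)) wt (weight-TV onCut block-label)
        where
        cond1 : ∀ H → IsBlock G H → Type1 G H → g (inj₂ H) ≤ 1
        cond1 H block t1 =
          let v , v∈ , ¬cutv = Type1⇒nonCut t1
          in ≤-trans (≤-reflexive (nonCut-label ¬cutv block v∈)) (L1 H block t1 v v∈ ¬cutv)
        cond2 : ∀ H → IsBlock G H → Type0 G H ⊎ Type2 G H → g (inj₂ H) ≡ 0
        cond2 H block (inj₁ t0) = trans (block-label H block) (nonCutSum-zero f λ v v∈ ¬cutv →
          contradiction t0 (nonCut⇒¬Type0 v∈ ¬cutv))
        cond2 H block (inj₂ t2) = trans (block-label H block) (nonCutSum-zero f (L2 H block t2))
        cond3 : _
        cond3 v cutv gv with near-protected v cutv (trans (sym (onCut v cutv)) gv)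
        ... | inj₁ (u , (tv , ≢v , near) , gu) = inj₁ (u , tv , ≢v , near , gu)
        ... | inj₂ (u₁ , u₂ , u₁≢u₂ , (tv₁ , ≢v₁ , near₁) , (tv₂ , ≢v₂ , near₂) , gu₁ , gu₂) =
          inj₂ (u₁ , u₂ , tv₁ , tv₂ , u₁≢u₂ , ≢v₁ , ≢v₂ , near₁ , near₂ , gu₁ , gu₂)
        cond4 : ∀ H → IsBlock G H → Type1 G H ⊎ Type2 G H → g (inj₂ H) ≡ 0 → Two (TAdj G (inj₂ H)) g
        cond4 H block t = block-protected H block
          ([ (λ t1 → ≤-reflexive (sym (Type1⇒count t1))) , (λ t2 → <⇒≤ (Type2⇒count t2)) ]′ t)

    -- From the labelling of T_G to the R2DF on `G`.

    module _ {γ g} (g≤2 : ∀ x → IsTV G x → g x ≤ 2) (conditions : CondB G γ g) where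
      private
        cond1 = proj₁ conditions
        cond2 = proj₁ (proj₂ conditions)
        cond3 = proj₁ (proj₂ (proj₂ conditions))
        cond4 = proj₁ (proj₂ (proj₂ (proj₂ conditions)))
        cond5 = proj₂ (proj₂ (proj₂ (proj₂ conditions)))

      pulledBack : Fin n → ℕ
      pulledBack v = g (carrier v)

      pulledBack-cut : ∀ v → IsCut G v → g (inj₁ v) ≡ pulledBack v
      pulledBack-cut v cutv = cong g (sym (carrier-cut cutv))

      pulledBack-nonCut : ∀ {v H} → ¬ IsCut G v → IsBlock G H → v ∈ H → pulledBack v ≡ g (inj₂ H)
      pulledBack-nonCut ¬cutv block v∈ = cong g (carrier-nonCut ¬cutv block v∈)

      -- Every non-cut vertex of `H` receives `g (inj₂ H)`, so the sum is a multiple of it. The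
      -- factor is 1 in type 1, and in the other types condition 2 makes the label 0.
      pulledBack-block : ∀ H → IsBlock G H → g (inj₂ H) ≡ nonCutSum pulledBack H
      pulledBack-block H block = sym (trans
        (nonCutSum-constant pulledBack (g (inj₂ H)) λ v v∈ ¬cutv → pulledBack-nonCut ¬cutv block v∈)
        (byType (types H)))
        where
        vanish : g (inj₂ H) ≡ 0 → nonCutCount H * g (inj₂ H) ≡ g (inj₂ H)
        vanish gH = trans (cong (nonCutCount H *_) gH) (trans (*-zeroʳ (nonCutCount H)) (sym gH))
        byType : Type0 G H ⊎ Type1 G H ⊎ Type2 G H → nonCutCount H * g (inj₂ H) ≡ g (inj₂ H)
        byType (inj₁ t0)        = vanish (cond2 H block (inj₁ t0))
        byType (inj₂ (inj₁ t1)) = trans (cong (_* g (inj₂ H)) (Type1⇒count t1)) (*-identityˡ _)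
        byType (inj₂ (inj₂ t2)) = vanish (cond2 H block (inj₂ t2))

      -- By condition 2 a block of positive label has type 1. Its non-cut vertex carries that label
      -- and is adjacent to `v` because the block is complete.
      near⇒neighbour : ∀ v → IsCut G v → ∀ x → Near v x → 1 ≤ g x →
        ∃ λ u → E G v u × pulledBack u ≡ g x × carrier u ≡ x
      near⇒neighbour v cutv (inj₁ u) (_ , ≢v , near) pos =
        let cutu , e = near-cut⇒neighbour ≢v near
        in u , e , sym (pulledBack-cut u cutu) , carrier-cut cutu
      near⇒neighbour v cutv (inj₂ H) (_ , _ , near) pos with near-block⇒∈ near | types H
      ... | block , v∈ | inj₁ t0        = contradiction (cond2 H block (inj₁ t0)) (>⇒≢ pos)
      ... | block , v∈ | inj₂ (inj₂ t2) = contradiction (cond2 H block (inj₂ t2)) (>⇒≢ pos)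
      ... | block , v∈ | inj₂ (inj₁ t1) =
        let u , u∈ , ¬cutu = Type1⇒nonCut t1
        in u , blockGraph H block v u v∈ u∈ (λ { refl → ¬cutu cutv }) ,
           pulledBack-nonCut ¬cutu block u∈ , carrier-nonCut ¬cutu block u∈

      cut-protected : ∀ v → IsCut G v → g (inj₁ v) ≡ 0 → Two (E G v) pulledBack
      cut-protected v cutv gv = Two-map (λ x u → carrier u ≡ x) (near⇒neighbour v cutv)
        -- Distinctness comes for free in this direction: `carrier` is a function, so different
        -- nodes have different preimages.
        (λ { refl refl → refl }) near
        where
        near : Two (Near v) g
        near with cond3 v cutv gv
        ... | inj₁ (u , tv , ≢v , near , gu) = inj₁ (u , (tv , ≢v , near) , gu)
        ... | inj₂ (u₁ , u₂ , tv₁ , tv₂ , u₁≢u₂ , ≢v₁ , ≢v₂ , near₁ , near₂ , gu₁ , gu₂) =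
          inj₂ (u₁ , u₂ , u₁≢u₂ , (tv₁ , ≢v₁ , near₁) , (tv₂ , ≢v₂ , near₂) , gu₁ , gu₂)

      -- The presence of `v` excludes type 0, so condition 4 applies. The neighbours of `H` in T_G
      -- are cut-vertices of the complete block `H`, hence neighbours of `v`.
      nonCut-protected : ∀ {v H} → ¬ IsCut G v → IsBlock G H → v ∈ H → g (inj₂ H) ≡ 0 →
        Two (E G v) pulledBack
      nonCut-protected {v} {H} ¬cutv block v∈ gH =
        Two-map (λ x u → carrier u ≡ x) send (λ { refl refl → refl }) (cond4 H block (type≥1 (types H)) gH)
        where
        type≥1 : Type0 G H ⊎ Type1 G H ⊎ Type2 G H → Type1 G H ⊎ Type2 G H
        type≥1 (inj₁ t0) = contradiction t0 (nonCut⇒¬Type0 v∈ ¬cutv)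
        type≥1 (inj₂ t)  = t
        send : ∀ x → TAdj G (inj₂ H) x → 1 ≤ g x → ∃ λ u → E G v u × pulledBack u ≡ g x × carrier u ≡ x
        send (inj₁ u) (cutu , _ , u∈) _ =
          u , blockGraph H block v u v∈ u∈ (λ { refl → ¬cutv cutu }) ,
          sym (pulledBack-cut u cutu) , carrier-cut cutu

      pulledBack-protected : ∀ v → Dec (IsCut G v) → pulledBack v ≡ 0 → Two (E G v) pulledBack
      pulledBack-protected v (yes cutv) fv = cut-protected v cutv (trans (pulledBack-cut v cutv) fv)
      pulledBack-protected v (no ¬cutv) fv = nonCut-protected ¬cutv (blockAt-IsBlock v) (∈-blockAt v)
        (trans (sym (pulledBack-nonCut ¬cutv (blockAt-IsBlock v) (∈-blockAt v))) fv)

      CondB⇒CondA : CondA G γ g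
      CondB⇒CondA = pulledBack ,
        ((λ v → g≤2 (carrier v) (carrier-IsTV v)) ,
         λ v fv → Two⇒sumOver≥2 (adj? G v) ∈-allFin (pulledBack-protected v (IsCut? v) fv)) ,
        -- `weight-TV` and condition 5 evaluate the same relational sum over T_G, so the two values
        -- agree.
        SumP-functional (weight-TV pulledBack-cut pulledBack-block) cond5 ,
        (λ H block t1 v v∈ ¬cutv →
          ≤-trans (≤-reflexive (pulledBack-nonCut ¬cutv block v∈)) (cond1 H block t1)) ,
        (λ H block t2 v v∈ ¬cutv →
          trans (pulledBack-nonCut ¬cutv block v∈) (cond2 H block (inj₂ t2))) ,
        pulledBack-cut ,
        λ H block → _ , _ ,
          SumP-sumOver (_∈? H) pulledBack (allFin n) ,
          SumP-sumOver (CutIn? H) pulledBack (allFin n) ,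
          trans (cong (_+ cutSum pulledBack H) (pulledBack-block H block))
                (trans (+-comm (nonCutSum pulledBack H) _) (sym (cutSum+nonCutSum pulledBack H)))

theorem9 : ∀ {n} (G : Graph n) → Connected G ⊤ → IsBlockGraph G → ¬ IsComplete G →
    (γ : ℕ) → IsGammaR2 G γ →
    (g : TV G → ℕ) → (∀ x → IsTV G x → g x ≤ 2) →
    CondA G γ g ⇔ CondB G γ g
theorem9 G _ blockGraph _ γ _ g g≤2 = mk⇔ (CondA⇒CondB G blockGraph) (CondB⇒CondA G blockGraph g≤2)
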